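{- Let $Q=T[H_1,\dots,H_t]$ be a strong semicomplete composition with $T\notin\mathcal{T}_1$. Then every minimal separator $S$ of $Q$ induces in $\overline{U(Q)}$ a subgraph which consists of some connected components of $\overline{U(Q)}$ (that is, $S$ is a union of vertex sets of connected components of $\overline{U(Q)}$). Moreover, each vertex $s\in S$ is adjacent in $Q$ to every vertex of $Q-S$ (i.e., for every $x\in V(Q)\setminus S$ there is at least one arc between $s$ and $x$ in $Q$).
   Context: Digraphs are finite, without loops or parallel arcs (2-cycles are allowed). A digraph is semicomplete if there is at least one arc between every pair of distinct vertices. Let $T$ be a digraph with vertices $u_1,\dots,u_t$ ($t\ge 2$) and let $H_1,\dots,H_t$ be pairwise disjoint nonempty digraphs, where $H_i$ has $n_i$ vertices. The composition $Q=T[H_1,\dots,H_t]$ is the digraph with vertex set $\bigcup_i V(H_i)$ and arc set $\bigcup_{i=1}^t A(H_i)\cup\{xy : x\in V(H_i),\ y\in V(H_p),\ u_iu_p\in A(T)\}$. It is a semicomplete composition if $T$ is semicomplete. A digraph is strong if for every ordered pair of vertices $(x,y)$ there is a directed path from $x$ to $y$ (a one-vertex digraph is strong). $\mathcal{T}_1$ is the set of all semicomplete digraphs $T$ for which there exists a vertex $u$ such that $uv,vu\in A(T)$ for every $v\in V(T)\setminus\{u\}$. $U(D)$ denotes the underlying undirected graph of $D$, and $\overline{G}$ the complement of a graph $G$. A set $S\subseteq V(D)$ is a separator of $D$ if $D-S$ is not strong; a separator is minimal if no proper subset of it is a separator. -}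

module Defs where

open import Data.Fin using (Fin)
open import Data.Fin.Properties using (_≟_)
open import Data.List using (List; []; _∷_)
open import Data.List.Relation.Unary.Unique.Propositional using (Unique)
open import Data.Nat using (ℕ)
open import Data.Product using (Σ; Σ-syntax; ∃-syntax; _×_; _,_)
open import Data.Refinement using (Refinement-syntax; value)
open import Data.Sum using (_⊎_; inj₁; inj₂; swap)
open import Function using (_∘_)
open import Level using (0ℓ)
open import Relation.Binary using (Rel; Symmetric) renaming (Decidable to Decidable₂)
open import Relation.Binary.Construct.Closure.ReflexiveTransitive using (Star; ε; _◅_)
open import Relation.Binary.PropositionalEquality using (_≢_; refl; ≢-sym)
open import Relation.Nullary using (¬_; yes; no)
open import Relation.Unary using (Pred; Decidable; _∉_; _⊂_; _≐_; ⋃)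

-- Arcs form a relation, so there are no parallel arcs, and 2-cycles are
-- allowed.  Finiteness is imposed by the choice of V (Fin n below).
record Digraph (V : Set) : Set₁ where
  infix 4 _⟶_ _⟶?_
  field
    _⟶_      : Rel V 0ℓ
    _⟶?_     : Decidable₂ _⟶_
    loopless : ∀ {x} → ¬ x ⟶ x

record Graph (V : Set) : Set₁ where
  infix 4 _~_
  field
    _~_      : Rel V 0ℓ
    ~-sym    : Symmetric _~_
    loopless : ∀ {x} → ¬ x ~ x

module _ {V : Set} {R : Rel V 0ℓ} where

  vertices : ∀ {x y} → Star R x y → List V
  vertices {x} ε       = x ∷ []
  vertices {x} (_ ◅ w) = x ∷ vertices w

-- A path is a walk without repeated vertices; ε is the one-vertex path.
Path : {V : Set} → Rel V 0ℓ → Rel V 0ℓ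
Path R x y = Σ[ w ∈ Star R x y ] Unique (vertices w)

Strong : {V : Set} → Digraph V → Set
Strong D = ∀ x y → Path (Digraph._⟶_ D) x y

module _ {V : Set} where

  Adjacent : Digraph V → Rel V 0ℓ
  Adjacent D x y = x ⟶ y ⊎ y ⟶ x
    where open Digraph D

  Semicomplete : Digraph V → Set
  Semicomplete D = ∀ {x y} → x ≢ y → Adjacent D x y

  𝒯₁ : Pred (Digraph V) 0ℓ
  𝒯₁ D = Semicomplete D × ∃[ u ] (∀ v → v ≢ u → u ⟶ v × v ⟶ u)
    where open Digraph D

  U : Digraph V → Graph V
  U D = record
    { _~_      = Adjacent D
    ; ~-sym    = swap
    ; loopless = λ where
        (inj₁ a) → Digraph.loopless D a
        (inj₂ a) → Digraph.loopless D a
    }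

  complement : Graph V → Graph V
  complement G = record
    { _~_      = λ x y → x ≢ y × ¬ x ~ y
    ; ~-sym    = λ (x≢y , x≁y) → ≢-sym x≢y , x≁y ∘ ~-sym
    ; loopless = λ (x≢x , _) → x≢x refl
    }
    where open Graph G

  -- C is the vertex set of a connected component of G, i.e. a class of the
  -- relation "joined by a path".
  IsComponent : Graph V → Pred V 0ℓ → Set
  IsComponent G C = ∃[ x ] C ≐ Path (Graph._~_ G) x

  IsUnionOfComponents : Graph V → Pred V 0ℓ → Set₁
  IsUnionOfComponents G S =
    Σ[ I ∈ Set ] Σ[ C ∈ (I → Pred V 0ℓ) ]
      (∀ i → IsComponent G (C i)) × S ≐ ⋃[ i ∶ I ] C i

  -- The proof of x ∉ S is irrelevant, so each x ∉ S is exactly one vertex of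
  -- D − S.
  infixl 6 _−_
  _−_ : Digraph V → (S : Pred V 0ℓ) → Digraph [ x ∈ V ∣ x ∉ S ]
  D − S = record
    { _⟶_      = λ x y → value x ⟶ value y
    ; _⟶?_     = λ x y → value x ⟶? value y
    ; loopless = loopless
    }
    where open Digraph D

  -- The empty digraph is (vacuously) strong, so V itself is no separator.
  Separator : Digraph V → Pred V 0ℓ → Set
  Separator D S = ¬ Strong (D − S)

  -- Subsets of a finite set are decidable predicates.
  MinimalSeparator : Digraph V → Pred V 0ℓ → Set₁
  MinimalSeparator D S =
    Separator D S × (∀ (S′ : Pred V 0ℓ) → Decidable S′ → S′ ⊂ S → ¬ Separator D S′)

module _ {t : ℕ} {n : Fin t → ℕ} where

  data CompositionArc (T : Digraph (Fin t)) (H : ∀ i → Digraph (Fin (n i))) :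
                      Rel (Σ (Fin t) (Fin ∘ n)) 0ℓ where
    inner : ∀ {i x y} → Digraph._⟶_ (H i) x y → CompositionArc T H (i , x) (i , y)
    outer : ∀ {i p x y} → Digraph._⟶_ T i p → CompositionArc T H (i , x) (p , y)

  infix 8 _[_]
  _[_] : Digraph (Fin t) → (∀ i → Digraph (Fin (n i))) → Digraph (Σ (Fin t) (Fin ∘ n))
  T [ H ] = record
    { _⟶_      = CompositionArc T H
    ; _⟶?_     = arc?
    ; loopless = λ where
        (inner a) → Digraph.loopless (H _) a
        (outer a) → Digraph.loopless T a
    }
    where
    arc? : Decidable₂ (CompositionArc T H)
    arc? (i , x) (p , y) with Digraph._⟶?_ T i p
    ... | yes a = yes (outer a)
    ... | no ¬a with i ≟ p
    ...   | no i≢p = no λ where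
              (inner _) → i≢p refl
              (outer a) → ¬a a
    ...   | yes refl with Digraph._⟶?_ (H i) x y
    ...     | yes b = yes (inner b)
    ...     | no ¬b = no λ where
                (inner b) → ¬b b
                (outer a) → ¬a a

{-# OPTIONS --safe #-}
module Submission where

open import Defs
open import Level using (0ℓ)
open import Data.Fin using (Fin; fromℕ<)
import Data.Fin.Properties as Fin
open import Data.Nat using (ℕ; _≤_)
open import Data.Product using (Σ; _×_; _,_; proj₁; proj₂; ∃₂; swap)
open import Function using (_∘_; _on_; flip; id)
open import Relation.Unary using (Pred; Decidable; _∈_; _∉_)

open import Data.Empty using (⊥-elim; ⊥-elim-irr)
open import Data.Irrelevant using () renaming ([_] to irr)
open import Data.List.Membership.DecPropositional using (_∈?_)
open import Data.List.Membership.Propositional using () renaming (_∈_ to _∈ˡ_)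
open import Data.List.Relation.Unary.All.Properties.Core using (¬Any⇒All¬)
open import Data.List.Relation.Unary.AllPairs using ([]; _∷_)
open import Data.List.Relation.Unary.Any using (here; there)
open import Data.List.Relation.Unary.Unique.Propositional using (Unique)
import Data.List.Relation.Unary.All as All
open import Data.Product.Properties using (≡-dec)
open import Data.Refinement using (Refinement-syntax; value; _,_; refine)
import Data.Refinement as Refinement
import Data.Sum as Sum
open import Relation.Binary using (Rel; DecidableEquality)
open import Relation.Binary.Construct.Closure.ReflexiveTransitive using (Star; ε; _◅_; _◅◅_; reverse)
open import Relation.Binary.PropositionalEquality using (_≡_; _≢_; refl; sym)
open import Relation.Nullary using (¬_; yes; no; ¬?; _×-dec_)
open import Relation.Nullary.Decidable using (decidable-stable)

-- Every minimal separator S is a union of blocks V(Hᵢ).  Suppose that s ∈ S and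
-- x ∉ S lie in the same block M.  By minimality Q − (S ∖ s) is strong.
-- If some vertex outside M survives in Q − S, then cutting the walks of
-- Q − (S ∖ s) where they first enter or last leave M, and replacing the vertex
-- of M there by x, which has the same arcs to and from the rest of Q, shows
-- that Q − S is strong, a contradiction.  So S contains everything outside M.
-- Then for y ∉ M the vertices of Q − (S ∖ y) are y and some of M, so strongness
-- gives arcs from M to y and from y to M; hence T ∈ 𝒯₁, a contradiction.

module _ {V : Set} {R : Rel V 0ℓ} where

  path-from : ∀ {x y z} (w : Star R y z) → Unique (vertices w) → x ∈ˡ vertices w → Path R x z
  path-from ε       u       (here refl) = ε , u
  path-from (a ◅ w) u       (here refl) = a ◅ w , u
  path-from (_ ◅ w) (_ ∷ u) (there x∈w) = path-from w u x∈w

  walk⇒path : DecidableEquality V → ∀ {x y} → Star R x y → Path R x y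
  walk⇒path _≟_ ε = ε , All.[] ∷ []
  walk⇒path _≟_ {x} (a ◅ w) with walk⇒path _≟_ w
  ... | p , u with _∈?_ _≟_ x (vertices p)
  -- A repeated `x` closes a cycle; dropping it keeps only the tail of `p` that starts at `x`.
  ...   | yes x∈p = path-from p u x∈p
  ...   | no  x∉p = a ◅ p , ¬Any⇒All¬ (vertices p) x∉p ∷ u

  crossing-arc : {P : Pred V 0ℓ} → Decidable P → ∀ {x y} → Star R x y → x ∈ P → y ∉ P →
                 ∃₂ λ a b → R a b × a ∈ P × b ∉ P
  crossing-arc P? ε x∈P y∉P = ⊥-elim (y∉P x∈P)
  crossing-arc P? (_◅_ {j = b} a w) x∈P y∉P with P? b
  ... | yes b∈P = crossing-arc P? w b∈P y∉P
  ... | no  b∉P = _ , _ , a , x∈P , b∉P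

module _ {V : Set} where

  infixl 6 _∖_
  _∖_ : Pred V 0ℓ → V → Pred V 0ℓ
  (S ∖ s) x = x ∈ S × x ≢ s

  -- Walks replace paths so that they can be cut and concatenated freely, and the bare relation `R`
  -- allows all arcs to be reversed by `flip`.
  Connected : Rel V 0ℓ → Pred V 0ℓ → Set
  Connected R S = ∀ (u v : [ x ∈ V ∣ x ∉ S ]) → Star (R on value) u v

  connected-flip : ∀ {R S} → Connected R S → Connected (flip R) S
  connected-flip conn u v = reverse id (conn v u)

  -- Minimality only refutes that `S ∖ s` is a separator, hence the double negation; it suffices for
  -- goals that are decidable or negated.
  minimal-∖ : DecidableEquality V → ∀ D {S} → Decidable S → MinimalSeparator D S →
              ∀ {s} → s ∈ S → ¬ ¬ Connected (Digraph._⟶_ D) (S ∖ s)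
  minimal-∖ _≟_ D {S} S? (_ , minimal) {s} s∈S ¬conn =
    minimal (S ∖ s) (λ x → S? x ×-dec ¬? (x ≟ s))
      (proj₁ , λ S⊆S∖s → proj₂ (S⊆S∖s s∈S) refl)
      (λ strong → ¬conn (λ u v → proj₁ (strong u v)))

  EntryInvariant : Rel V 0ℓ → Pred V 0ℓ → Set
  EntryInvariant R M = ∀ {u a b} → u ∉ M → a ∈ M → b ∈ M → R u a → R u b

  -- These are the modules of modular decomposition.
  Homogeneous : Rel V 0ℓ → Pred V 0ℓ → Set
  Homogeneous R M = EntryInvariant R M × EntryInvariant (flip R) M

  module _ {M S : Pred V 0ℓ} (M? : Decidable M) {s : V} (s∈M : s ∈ M) where

    outside : (u : [ x ∈ V ∣ x ∉ S ∖ s ]) → value u ∉ M → [ x ∈ V ∣ x ∉ S ]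
    outside (u , irr u∉S∖s) u∉M = u , irr (λ u∈S → u∉S∖s (u∈S , λ { refl → u∉M s∈M }))

    restore : [ x ∈ V ∣ x ∉ S ] → [ x ∈ V ∣ x ∉ S ∖ s ]
    restore = refine (_∘ proj₁)

    -- Before its first entry into `M` the walk misses `s`, so it avoids all of `S`; the entering
    -- arc is redirected to `x`.
    walk-into : ∀ {R} → EntryInvariant R M → (x : [ x ∈ V ∣ x ∉ S ]) → value x ∈ M →
                ∀ {u v} → Star (R on value) u v → (u∉M : value u ∉ M) → value v ∈ M →
                Star (R on value) (outside u u∉M) x
    walk-into inv x x∈M ε u∉M v∈M = ⊥-elim (u∉M v∈M)
    walk-into inv x x∈M (_◅_ {j = b} a w) u∉M v∈M with M? (value b)
    ... | yes b∈M = inv u∉M b∈M x∈M a ◅ ε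
    ... | no  b∉M = a ◅ walk-into inv x x∈M w b∉M v∈M

    walk-to : ∀ {R} → Homogeneous R M → Connected R (S ∖ s) →
              ∀ (x z : [ x ∈ V ∣ x ∉ S ]) → value x ∈ M → value z ∉ M →
              ∀ u → Star (R on value) u x
    walk-to (enter , leave) conn x z x∈M z∉M u with M? (value u)
    ... | no  u∉M = walk-into enter x x∈M (conn (restore u) (restore x)) u∉M x∈M
    -- The vertex `z` forces some arc to leave `M`; moving its tail to `u` lets `u` step out of `M`,
    -- from where a walk leads back to `x`.
    ... | yes u∈M with crossing-arc (M? ∘ value) (conn (restore x) (restore z)) x∈M z∉M
    ...   | a , b , a⟶b , a∈M , b∉M =
      leave b∉M a∈M u∈M a⟶b ◅ walk-into enter x x∈M (conn b (restore x)) b∉M x∈M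

    -- The vertex `x` serves as a hub: every vertex reaches it, and so, with all arcs reversed, it
    -- reaches every vertex.
    connected-restrict : ∀ {R} → Homogeneous R M → Connected R (S ∖ s) →
                         ∀ (x z : [ x ∈ V ∣ x ∉ S ]) → value x ∈ M → value z ∉ M →
                         Connected R S
    connected-restrict hom conn x z x∈M z∉M u v =
      walk-to hom conn x z x∈M z∉M u
        ◅◅ reverse id (walk-to (swap hom) (connected-flip conn) x z x∈M z∉M v)

  -- A walk from `x` to `y` must leave `M`, and `y` is the only vertex outside `M` that survives the
  -- removal of `S ∖ y`.
  arc-to-unique-outsider : DecidableEquality V → ∀ {R} {M S : Pred V 0ℓ} → Decidable M →
    (∀ {w} → w ∉ M → w ∈ S) → ∀ {x y} → x ∈ M → x ∉ S → y ∉ M →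
    Connected R (S ∖ y) → Σ V λ a → a ∈ M × R a y
  arc-to-unique-outsider _≟_ M? M∁⊆S {x} {y} x∈M x∉S y∉M conn
    with crossing-arc (M? ∘ value) (conn (x , irr (x∉S ∘ proj₁)) (y , irr (λ y∈ → proj₂ y∈ refl))) x∈M y∉M
  ... | a , (b , irr b∉S∖y) , a⟶b , a∈M , b∉M with b ≟ y
  ...   | yes refl = value a , a∈M , a⟶b
  ...   | no  b≢y  = ⊥-elim-irr (b∉S∖y (M∁⊆S b∉M , b≢y))

module _ {t : ℕ} {n : Fin t → ℕ} (T : Digraph (Fin t)) (H : ∀ i → Digraph (Fin (n i))) where

  private
    Vertex : Set
    Vertex = Σ (Fin t) (Fin ∘ n)

    _≟_ : DecidableEquality Vertex
    _≟_ = ≡-dec Fin._≟_ Fin._≟_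

  open Digraph T

  Block : Fin t → Pred Vertex 0ℓ
  Block i u = proj₁ u ≡ i

  block? : ∀ i → Decidable (Block i)
  block? i u = proj₁ u Fin.≟ i

  arc⇒outer : ∀ {u v} → proj₁ u ≢ proj₁ v → CompositionArc T H u v → proj₁ u ⟶ proj₁ v
  arc⇒outer u≢v (inner _) = ⊥-elim (u≢v refl)
  arc⇒outer u≢v (outer a) = a

  -- Arcs between different blocks come from `T` and depend only on the block indices.
  block-homogeneous : ∀ i → Homogeneous (CompositionArc T H) (Block i)
  block-homogeneous i =
      (λ { u∉M refl refl a → outer (arc⇒outer u∉M a) })
    , (λ { u∉M refl refl a → outer (arc⇒outer (u∉M ∘ sym) a) })

  module _ {S : Pred Vertex 0ℓ} (S? : Decidable S) (S-min : MinimalSeparator (T [ H ]) S)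
           {i : Fin t} {a b : Fin (n i)} (a∈S : (i , a) ∈ S) (b∉S : (i , b) ∉ S) where

    mixed-block⇒outside⊆S : ∀ {w} → w ∉ Block i → w ∈ S
    mixed-block⇒outside⊆S {w} w∉M = decidable-stable (S? w) λ w∉S →
      minimal-∖ _≟_ (T [ H ]) S? S-min a∈S λ conn →
      proj₁ S-min λ u v → walk⇒path (Refinement._≟_ _≟_)
        (connected-restrict (block? i) refl (block-homogeneous i) conn
          ((i , b) , irr b∉S) (w , irr w∉S) refl w∉M u v)

    mixed-block⇒bidirected : (∀ j → 1 ≤ n j) → ∀ j → j ≢ i → i ⟶ j × j ⟶ i
    mixed-block⇒bidirected 1≤n j j≢i =
      decidable-stable ((i ⟶? j) ×-dec (j ⟶? i)) λ ¬arcs →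
      -- Any vertex `y` of block `j` lies in `S`, so minimality applies to `S ∖ y`.
      minimal-∖ _≟_ (T [ H ]) S? S-min (mixed-block⇒outside⊆S {y} j≢i) λ conn →
      ¬arcs (from conn , to conn)
      where
      y : Vertex
      y = j , fromℕ< (1≤n j)

      from : Connected (CompositionArc T H) (S ∖ y) → i ⟶ j
      from conn with arc-to-unique-outsider _≟_ (block? i) mixed-block⇒outside⊆S refl b∉S j≢i conn
      ... | _ , refl , c = arc⇒outer (j≢i ∘ sym) c

      to : Connected (CompositionArc T H) (S ∖ y) → j ⟶ i
      to conn with arc-to-unique-outsider _≟_ (block? i) mixed-block⇒outside⊆S refl b∉S j≢i
                     (connected-flip conn)
      ... | _ , refl , c = arc⇒outer j≢i c

  minimalSeparator-adjacent : (∀ j → 1 ≤ n j) → Semicomplete T → T ∉ 𝒯₁ →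
    {S : Pred Vertex 0ℓ} → Decidable S → MinimalSeparator (T [ H ]) S →
    ∀ s x → s ∈ S → x ∉ S → Adjacent (T [ H ]) s x
  minimalSeparator-adjacent 1≤n semi T∉𝒯₁ S? S-min (i , _) (p , _) s∈S x∉S with i Fin.≟ p
  ... | yes refl = ⊥-elim (T∉𝒯₁ (semi , i , mixed-block⇒bidirected S? S-min s∈S x∉S 1≤n))
  ... | no  i≢p  = Sum.map outer outer (semi i≢p)

closed⇒unionOfComponents : {V : Set} (G : Graph V) {S : Pred V 0ℓ} →
  (∀ {x y} → Graph._~_ G x y → x ∈ S → y ∈ S) → IsUnionOfComponents G S
closed⇒unionOfComponents {V} G {S} closed =
    -- The elements of `S` index the components, so a component may be listed repeatedly.
    Σ V S , (λ (s , _) → Path _~_ s)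
  , (λ (s , _) → s , id , id)
  , (λ {x} x∈S → (x , x∈S) , ε , All.[] ∷ [])
  , (λ ((_ , s∈S) , w , _) → walk-closed w s∈S)
  where
  open Graph G

  walk-closed : ∀ {x y} → Star _~_ x y → x ∈ S → y ∈ S
  walk-closed ε       x∈S = x∈S
  walk-closed (e ◅ w) x∈S = walk-closed w (closed e x∈S)

theorem2p2 : (t : ℕ) → 2 ≤ t → (n : Fin t → ℕ) → (∀ i → 1 ≤ n i) →
    (T : Digraph (Fin t)) (H : ∀ i → Digraph (Fin (n i))) →
    Semicomplete T → Strong (T [ H ]) → T ∉ 𝒯₁ →
    (S : Pred (Σ (Fin t) (Fin ∘ n)) 0ℓ) → Decidable S → MinimalSeparator (T [ H ]) S →
    IsUnionOfComponents (complement (U (T [ H ]))) S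
    × (∀ s x → s ∈ S → x ∉ S → Adjacent (T [ H ]) s x)
theorem2p2 t _ n 1≤n T H semi _ T∉𝒯₁ S S? S-min =
    -- An edge of the complement leaving `S` would join two vertices that `adjacent` makes adjacent
    -- in `T [ H ]`.
    closed⇒unionOfComponents (complement (U (T [ H ]))) (λ {x} {y} (_ , x≁y) x∈S →
      decidable-stable (S? y) (x≁y ∘ adjacent x y x∈S))
  , adjacent
  where
  adjacent : ∀ s x → s ∈ S → x ∉ S → Adjacent (T [ H ]) s x
  adjacent = minimalSeparator-adjacent T H 1≤n semi T∉𝒯₁ S? S-min
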